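{- Let $G$ be an embedded graph. Then $$P(G;\lambda)=\sum_{A\subseteq E(G)}(-1)^{|A|}\,\chi\big((G^{\tau(A)})^*;\lambda\big).$$
   Context: An embedded graph is a graph (loops and multiple edges allowed, not necessarily connected) cellularly embedded in a closed, possibly non-orientable, surface, i.e. each component of the complement (each face) is an open disc. Equivalently, it is a ribbon graph: a surface with boundary written as a union of vertex discs and edge discs (ribbons), each edge disc meeting the vertex discs in exactly two disjoint arcs. $f(G)$ is the number of boundary components of the ribbon graph (number of faces). The partial Petrial $G^{\tau(A)}$, $A\subseteq E(G)$, is the ribbon graph obtained from $G$ by adding a half-twist to each edge in $A$. $G^*$ denotes the geometric dual of an embedded graph $G$. Penrose polynomial: $P(G;\lambda)=\sum_{A\subseteq E(G)}(-1)^{|A|}\lambda^{f(G^{\tau(A)})}$. $\chi(H;\lambda)$ is the chromatic polynomial of the underlying abstract graph of $H$ (it is $0$ if $H$ has a loop). -}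

module Defs where

open import Algebra.Definitions using (Involutive)
open import Data.Bool using (Bool; true; false; if_then_else_)
open import Data.Fin using (Fin; zero; suc; punchIn; punchOut; _↑ˡ_; _≟_)
open import Data.Fin.Properties using (punchInᵢ≢i; punchIn-punchOut; punchOut-injective; punchOut-cong; punchOut-punchIn)
open import Data.Fin.Subset using (Subset; inside; outside; ∣_∣)
open import Data.Integer as ℤ using (ℤ; +_; 0ℤ; 1ℤ; -1ℤ)
import Data.Integer.Properties as ℤₚ
open import Data.Integer.Tactic.RingSolver using (solve-∀)
open import Data.List using (List; []; _∷_; _++_; map; filter; length; foldr; tabulate; allFin; replicate; cartesianProductWith)
open import Data.List.Membership.Propositional using (_∈_)
open import Data.List.Membership.Propositional.Properties using (∈-++⁺ˡ; ∈-++⁺ʳ; ∈-++⁻; ∈-tabulate⁺; ∈-tabulate⁻)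
open import Data.List.Properties using (map-tabulate; length-tabulate)
open import Data.List.Relation.Unary.All as All using (All; []; _∷_)
open import Data.List.Relation.Unary.Any using (here; there)
open import Data.Nat using (ℕ; zero; suc; pred; _+_; _*_; _^_)
import Data.Nat.Properties as ℕₚ
import Data.Nat.Tactic.RingSolver as ℕSolver
open import Data.Product using (_×_; _,_; proj₁; proj₂; ∃)
open import Data.Sum using (_⊎_; inj₁; inj₂)
open import Data.Vec as Vec using (Vec; lookup; insertAt)
open import Data.Vec.Properties using (insertAt-lookup; insertAt-punchIn)
open import Function using (_∘_; id)
open import Function.Definitions using (StrictlySurjective)
open import Level using (0ℓ)
open import Relation.Binary.Core using (Rel)
open import Relation.Binary.Construct.Closure.Equivalence as EqC using (EqClosure)
open import Relation.Binary.PropositionalEquality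
open import Relation.Nullary using (¬_; Dec; yes; no; contradiction; ¬?)
open import Relation.Unary using (Decidable)

------------------------------------------------------------------------
-- Integer polynomials

-- Coefficient lists, constant term first.  Trailing zeros are allowed, so
-- equality of polynomials is _≈ₚ_.
Poly : Set
Poly = List ℤ

coeff : Poly → ℕ → ℤ
coeff []      _       = 0ℤ
coeff (a ∷ p) zero    = a
coeff (a ∷ p) (suc i) = coeff p i

infix 4 _≈ₚ_
_≈ₚ_ : Poly → Poly → Set
p ≈ₚ q = ∀ i → coeff p i ≡ coeff q i

infixl 6 _+ₚ_ _-ₚ_
infixr 7 _·ₚ_

_+ₚ_ : Poly → Poly → Poly
[]      +ₚ q       = q
(a ∷ p) +ₚ []      = a ∷ p
(a ∷ p) +ₚ (b ∷ q) = (a ℤ.+ b) ∷ (p +ₚ q)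

_·ₚ_ : ℤ → Poly → Poly
a ·ₚ p = map (a ℤ.*_) p

_-ₚ_ : Poly → Poly → Poly
p -ₚ q = p +ₚ -1ℤ ·ₚ q

X^_ : ℕ → Poly
X^ n = replicate n 0ℤ ++ (1ℤ ∷ [])

eval : Poly → ℤ → ℤ
eval []      x = 0ℤ
eval (a ∷ p) x = a ℤ.+ x ℤ.* eval p x

subsets : ∀ n → List (Subset n)
subsets zero    = Vec.[] ∷ []
subsets (suc n) = map (outside Vec.∷_) (subsets n) ++ map (inside Vec.∷_) (subsets n)

∑⊆ : ∀ {n} → (Subset n → Poly) → Poly
∑⊆ {n} f = foldr _+ₚ_ [] (map f (subsets n))

[-1]^ : ℕ → ℤ
[-1]^ m = -1ℤ ℤ.^ m

------------------------------------------------------------------------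
-- Equivalence classes on a finite set

record Quotient {n : ℕ} (R : Rel (Fin n) 0ℓ) : Set where
  field
    classes    : ℕ
    class      : Fin n → Fin classes
    surjective : StrictlySurjective _≡_ class
    sound      : ∀ {x y} → EqClosure R x y → class x ≡ class y
    complete   : ∀ {x y} → class x ≡ class y → EqClosure R x y

-- merge identifies b with a and is injective otherwise; redirect is the
-- same map before b is deleted from its codomain.
module _ {n : ℕ} {a b : Fin n} (a≢b : a ≢ b) where

  redirect : Fin n → Fin n
  redirect x with x ≟ b
  ... | yes _ = a
  ... | no  _ = x

  b≢redirect : ∀ x → b ≢ redirect x
  b≢redirect x with x ≟ b
  ... | yes _   = a≢b ∘ sym
  ... | no  x≢b = x≢b ∘ sym

  redirect-b : redirect b ≡ a
  redirect-b with b ≟ b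
  ... | yes _   = refl
  ... | no  b≢b = contradiction refl b≢b

  redirect-≢ : ∀ {x} → x ≢ b → redirect x ≡ x
  redirect-≢ {x} x≢b with x ≟ b
  ... | yes x≡b = contradiction x≡b x≢b
  ... | no  _   = refl

merge : ∀ {n} {a b : Fin n} → a ≢ b → Fin n → Fin (pred n)
merge {suc n} a≢b x = punchOut (b≢redirect a≢b x)

merge-≡ : ∀ {n} {a b : Fin n} (a≢b : a ≢ b) → merge a≢b a ≡ merge a≢b b
merge-≡ {suc n} {a} {b} a≢b =
  punchOut-cong b (trans (redirect-≢ a≢b a≢b) (sym (redirect-b a≢b)))

merge-injective : ∀ {n} {a b : Fin n} (a≢b : a ≢ b) {x y} →
                  merge a≢b x ≡ merge a≢b y → redirect a≢b x ≡ redirect a≢b y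
merge-injective {suc n} a≢b {x} {y} =
  punchOut-injective (b≢redirect a≢b x) (b≢redirect a≢b y)

merge-surjective : ∀ {n} {a b : Fin n} (a≢b : a ≢ b) → StrictlySurjective _≡_ (merge a≢b)
merge-surjective {suc n} {a} {b} a≢b j =
  punchIn b j ,
  trans (punchOut-cong b {i≢k = punchInᵢ≢i b j ∘ sym} (redirect-≢ a≢b (punchInᵢ≢i b j)))
        (punchOut-punchIn b)

quotient-list : ∀ {n} (ps : List (Fin n × Fin n)) → Quotient (λ x y → (x , y) ∈ ps)
quotient-list {n} [] = record
  { classes    = n
  ; class      = id
  ; surjective = λ j → j , refl
  ; sound      = EqC.fold isEquivalence (λ ())
  ; complete   = λ { refl → EqC.reflexive _ }
  }
quotient-list {n} ((a , b) ∷ ps) with quotient-list ps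
... | Q with Quotient.class Q a ≟ Quotient.class Q b
... | yes a≡b = record
  { classes    = classes
  ; class      = class
  ; surjective = surjective
  ; sound      = EqC.fold (record { refl = refl ; sym = sym ; trans = trans })
                   λ { (here refl) → a≡b ; (there m) → sound (EqC.return m) }
  ; complete   = EqC.map there ∘ complete
  }
  where open Quotient Q
... | no a≢b = record
  { classes    = pred classes
  ; class      = merge a≢b ∘ class
  ; surjective = λ j →
      let (i , i↦j) = merge-surjective a≢b j
          (x , x↦i) = surjective i
      in x , trans (cong (merge a≢b) x↦i) i↦j
  ; sound      = EqC.fold (record { refl = refl ; sym = sym ; trans = trans })
                   λ { (here refl) → merge-≡ a≢b
                     ; (there m)   → cong (merge a≢b) (sound (EqC.return m)) }
  ; complete   = λ {x} {y} → complete′ x y ∘ merge-injective a≢b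
  }
  where
  open Quotient Q
  R′ : Rel (Fin n) 0ℓ
  R′ x y = (x , y) ∈ ((a , b) ∷ ps)
  old : ∀ {x y} → class x ≡ class y → EqClosure R′ x y
  old = EqC.map there ∘ complete
  ab : EqClosure R′ a b
  ab = EqC.return (here refl)
  ba : EqClosure R′ b a
  ba = EqC.symmetric _ ab
  _⨾_ : ∀ {x y z} → EqClosure R′ x y → EqClosure R′ y z → EqClosure R′ x z
  _⨾_ = EqC.transitive _
  complete′ : ∀ x y → redirect a≢b (class x) ≡ redirect a≢b (class y) → EqClosure R′ x y
  complete′ x y eq with class x ≟ class b | class y ≟ class b
  ... | yes p | yes q = old (trans p (sym q))
  ... | yes p | no  _ = old p ⨾ (ba ⨾ old eq)
  ... | no  _ | yes q = old eq ⨾ (ab ⨾ old (sym q))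
  ... | no  _ | no  _ = old eq

⟨_,_⟩-quotient : ∀ {n} (σ τ : Fin n → Fin n) → Quotient (λ x y → y ≡ σ x ⊎ y ≡ τ x)
⟨_,_⟩-quotient {n} σ τ = record
  { classes    = classes
  ; class      = class
  ; surjective = surjective
  ; sound      = sound ∘ EqC.map to
  ; complete   = EqC.map from ∘ complete
  }
  where
  graphOf : (Fin n → Fin n) → List (Fin n × Fin n)
  graphOf f = tabulate (λ x → x , f x)
  open Quotient (quotient-list (graphOf σ ++ graphOf τ))
  to : ∀ {x y} → y ≡ σ x ⊎ y ≡ τ x → (x , y) ∈ (graphOf σ ++ graphOf τ)
  to {x} (inj₁ refl) = ∈-++⁺ˡ (∈-tabulate⁺ {f = λ x → x , σ x} x)
  to {x} (inj₂ refl) = ∈-++⁺ʳ (graphOf σ) (∈-tabulate⁺ {f = λ x → x , τ x} x)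
  from : ∀ {x y} → (x , y) ∈ (graphOf σ ++ graphOf τ) → y ≡ σ x ⊎ y ≡ τ x
  from m with ∈-++⁻ (graphOf σ) m
  ... | inj₁ l with ∈-tabulate⁻ l
  ...   | _ , refl = inj₁ refl
  from m | inj₂ r with ∈-tabulate⁻ r
  ...   | _ , refl = inj₂ refl

------------------------------------------------------------------------
-- Abstract graphs and the chromatic polynomial

-- Loops and multiple edges are allowed; the order of the edges and of the
-- two ends of an edge carries no meaning.
record Graph : Set where
  field
    #vertices : ℕ
    edges     : List (Fin #vertices × Fin #vertices)

colourings : ∀ k v → List (Vec (Fin k) v)
colourings k zero    = Vec.[] ∷ []
colourings k (suc v) = cartesianProductWith Vec._∷_ (allFin k) (colourings k v)

Proper : (H : Graph) {k : ℕ} → Vec (Fin k) (Graph.#vertices H) → Set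
Proper H c = All (λ (u , v) → lookup c u ≢ lookup c v) (Graph.edges H)

proper? : (H : Graph) {k : ℕ} → Decidable (Proper H {k})
proper? H c = All.all? (λ (u , v) → ¬? (lookup c u ≟ lookup c v)) (Graph.edges H)

#properColourings : Graph → ℕ → ℕ
#properColourings H k = length (filter (proper? H) (colourings k (Graph.#vertices H)))

-- This determines the polynomial up to _≈ₚ_.
IsChromaticPolynomial : Graph → Poly → Set
IsChromaticPolynomial H p = ∀ k → eval p (+ k) ≡ + #properColourings H k

-- Deletion–contraction.  The graph being considered has vertex set Fin v
-- and an edge between q x and q y for each listed pair (x , y); q records
-- the contractions made so far.
chromatic : ∀ {n v} → (Fin n → Fin v) → List (Fin n × Fin n) → Poly
chromatic {v = v} q [] = X^ v
chromatic q ((x , y) ∷ es) with q x ≟ q y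
... | yes _     = []
... | no  qx≢qy = chromatic q es -ₚ chromatic (merge qx≢qy ∘ q) es

χ : Graph → Poly
χ H = chromatic id (Graph.edges H)

module ChromaticCount where

  eval-+ : ∀ p q x → eval (p +ₚ q) x ≡ eval p x ℤ.+ eval q x
  eval-+ []      q       x = sym (ℤₚ.+-identityˡ _)
  eval-+ (a ∷ p) []      x = sym (ℤₚ.+-identityʳ _)
  eval-+ (a ∷ p) (b ∷ q) x = trans
    (cong (λ t → a ℤ.+ b ℤ.+ x ℤ.* t) (eval-+ p q x))
    (lem a b x (eval p x) (eval q x))
    where
    lem : ∀ a b x s t → a ℤ.+ b ℤ.+ x ℤ.* (s ℤ.+ t) ≡ (a ℤ.+ x ℤ.* s) ℤ.+ (b ℤ.+ x ℤ.* t)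
    lem = solve-∀

  eval-· : ∀ a p x → eval (a ·ₚ p) x ≡ a ℤ.* eval p x
  eval-· a []      x = sym (ℤₚ.*-zeroʳ a)
  eval-· a (b ∷ p) x = trans
    (cong (λ t → a ℤ.* b ℤ.+ x ℤ.* t) (eval-· a p x))
    (lem a b x (eval p x))
    where
    lem : ∀ a b x s → a ℤ.* b ℤ.+ x ℤ.* (a ℤ.* s) ≡ a ℤ.* (b ℤ.+ x ℤ.* s)
    lem = solve-∀

  eval-- : ∀ p q x → eval (p -ₚ q) x ≡ eval p x ℤ.- eval q x
  eval-- p q x = trans (eval-+ p (-1ℤ ·ₚ q) x)
    (cong (λ t → eval p x ℤ.+ t) (trans (eval-· -1ℤ q x) (ℤₚ.-1*i≡-i (eval q x))))

  eval-X^ : ∀ n k → eval (X^ n) (+ k) ≡ + (k ^ n)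
  eval-X^ zero    k = cong (λ t → 1ℤ ℤ.+ t) (ℤₚ.*-zeroʳ (+ k))
  eval-X^ (suc n) k = trans (ℤₚ.+-identityˡ _)
    (trans (cong (+ k ℤ.*_) (eval-X^ n k)) (sym (ℤₚ.pos-* k (k ^ n))))

  ∑ : ∀ {A : Set} → List A → (A → ℕ) → ℕ
  ∑ []       f = 0
  ∑ (x ∷ xs) f = f x + ∑ xs f

  ind : ∀ {P : Set} → Dec P → ℕ
  ind (yes _) = 1
  ind (no _)  = 0

  ind-cong : ∀ {P Q : Set} (p : Dec P) (q : Dec Q) → (P → Q) → (Q → P) → ind p ≡ ind q
  ind-cong (yes _) (yes _) f g = refl
  ind-cong (no _)  (no _)  f g = refl
  ind-cong (yes p) (no ¬q) f g = contradiction (f p) ¬q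
  ind-cong (no ¬p) (yes q) f g = contradiction (g q) ¬p

  module _ {A : Set} where

    length-filter : {P : A → Set} (P? : Decidable P) (xs : List A) →
                    length (filter P? xs) ≡ ∑ xs (ind ∘ P?)
    length-filter P? [] = refl
    length-filter P? (x ∷ xs) with P? x
    ... | yes _ = cong suc (length-filter P? xs)
    ... | no  _ = length-filter P? xs

    ∑-cong : ∀ {f g : A → ℕ} (xs : List A) → (∀ x → f x ≡ g x) → ∑ xs f ≡ ∑ xs g
    ∑-cong []       eq = refl
    ∑-cong (x ∷ xs) eq = cong₂ _+_ (eq x) (∑-cong xs eq)

    ∑-0 : (xs : List A) → ∑ xs (λ _ → 0) ≡ 0
    ∑-0 []       = refl
    ∑-0 (_ ∷ xs) = ∑-0 xs

    ∑-+ : ∀ (f g : A → ℕ) xs → ∑ xs (λ x → f x + g x) ≡ ∑ xs f + ∑ xs g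
    ∑-+ f g []       = refl
    ∑-+ f g (x ∷ xs) = trans (cong (λ t → f x + g x + t) (∑-+ f g xs)) (lem (f x) (g x) (∑ xs f) (∑ xs g))
      where
      lem : ∀ a b c d → a + b + (c + d) ≡ a + c + (b + d)
      lem = ℕSolver.solve-∀

    ∑-++ : ∀ (f : A → ℕ) xs ys → ∑ (xs ++ ys) f ≡ ∑ xs f + ∑ ys f
    ∑-++ f []       ys = refl
    ∑-++ f (x ∷ xs) ys = trans (cong (λ t → f x + t) (∑-++ f xs ys)) (sym (ℕₚ.+-assoc (f x) _ _))

    ∑-const : ∀ m (xs : List A) → ∑ xs (λ _ → m) ≡ length xs * m
    ∑-const m []       = refl
    ∑-const m (x ∷ xs) = cong (λ t → m + t) (∑-const m xs)

  module _ {A B : Set} where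

    ∑-map : ∀ (f : B → ℕ) (g : A → B) xs → ∑ (map g xs) f ≡ ∑ xs (f ∘ g)
    ∑-map f g []       = refl
    ∑-map f g (x ∷ xs) = cong (λ t → f (g x) + t) (∑-map f g xs)

    ∑-swap : ∀ (f : A → B → ℕ) xs ys → ∑ xs (λ x → ∑ ys (f x)) ≡ ∑ ys (λ y → ∑ xs (λ x → f x y))
    ∑-swap f []       ys = sym (∑-0 ys)
    ∑-swap f (x ∷ xs) ys = trans (cong (λ t → ∑ ys (f x) + t) (∑-swap f xs ys))
      (sym (∑-+ (f x) (λ y → ∑ xs (λ x → f x y)) ys))

  ∑-product : ∀ {A B C : Set} (f : C → ℕ) (g : A → B → C) xs ys →
              ∑ (cartesianProductWith g xs ys) f ≡ ∑ xs (λ x → ∑ ys (f ∘ g x))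
  ∑-product f g []       ys = refl
  ∑-product f g (x ∷ xs) ys = trans (∑-++ f (map (g x) ys) _)
    (cong₂ _+_ (∑-map f (g x) ys) (∑-product f g xs ys))

  ∑-allFin : ∀ {k} (f : Fin (suc k) → ℕ) → ∑ (allFin (suc k)) f ≡ f zero + ∑ (allFin k) (f ∘ suc)
  ∑-allFin {k} f = cong (λ t → f zero + t)
    (trans (cong (λ l → ∑ l f) (sym (map-tabulate id suc))) (∑-map f suc (allFin k)))

  ∑-single : ∀ {k} (y : Fin k) (f : Fin k → ℕ) → (∀ x → x ≢ y → f x ≡ 0) → ∑ (allFin k) f ≡ f y
  ∑-single {suc k} zero f z = trans (∑-allFin f) (trans
    (cong (λ t → f zero + t) (trans (∑-cong (allFin k) (λ x → z (suc x) (λ ()))) (∑-0 (allFin k))))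
    (ℕₚ.+-identityʳ _))
  ∑-single {suc k} (suc y) f z = trans (∑-allFin f)
    (cong₂ _+_ (z zero (λ ())) (∑-single y (f ∘ suc) (λ x x≢y → z (suc x) (λ { refl → x≢y refl }))))

  ∑-colourings-1 : ∀ k v → ∑ (colourings k v) (λ _ → 1) ≡ k ^ v
  ∑-colourings-1 k zero    = refl
  ∑-colourings-1 k (suc v) = trans (∑-product _ Vec._∷_ (allFin k) (colourings k v))
    (trans (∑-cong (allFin k) (λ _ → ∑-colourings-1 k v))
      (trans (∑-const (k ^ v) (allFin k)) (cong (_* k ^ v) (length-tabulate {n = k} id))))

  ∑-insertAt : ∀ k {v} (b : Fin (suc v)) (f : Vec (Fin k) (suc v) → ℕ) →
               ∑ (colourings k (suc v)) f ≡
               ∑ (colourings k v) (λ c → ∑ (allFin k) (λ x → f (insertAt c b x)))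
  ∑-insertAt k {v} zero f = trans (∑-product f Vec._∷_ (allFin k) (colourings k v))
    (∑-swap (λ x c → f (x Vec.∷ c)) (allFin k) (colourings k v))
  ∑-insertAt k {suc v} (suc b) f = trans
    (∑-product f Vec._∷_ (allFin k) (colourings k (suc v)))
    (trans
      (∑-cong (allFin k) (λ y → ∑-insertAt k b (λ c → f (y Vec.∷ c))))
      (sym (∑-product (λ c → ∑ (allFin k) (λ x → f (insertAt c (suc b) x)))
              Vec._∷_ (allFin k) (colourings k v))))

  module _ {n v k : ℕ} (q : Fin n → Fin v) (es : List (Fin n × Fin n)) where

    Properᵍ : Vec (Fin k) v → Set
    Properᵍ c = All (λ (x , y) → lookup c (q x) ≢ lookup c (q y)) es

    properᵍ? : Decidable Properᵍ
    properᵍ? c = All.all? (λ (x , y) → ¬? (lookup c (q x) ≟ lookup c (q y))) es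

  #ᵍ : ∀ {n v} → (Fin n → Fin v) → List (Fin n × Fin n) → ℕ → ℕ
  #ᵍ {v = v} q es k = ∑ (colourings k v) (ind ∘ properᵍ? q es)

  lookup-merge : ∀ {v k} {a b : Fin (suc v)} (a≢b : a ≢ b) (c : Vec (Fin k) v) x →
                 lookup (insertAt c b (lookup c (merge a≢b a))) x ≡ lookup c (merge a≢b x)
  lookup-merge {a = a} {b} a≢b c x = go (x ≟ b)
    where
    go : Dec (x ≡ b) → _
    go (yes refl) = trans (insertAt-lookup c b _) (cong (lookup c) (merge-≡ a≢b))
    go (no x≢b)   = trans
      (cong (lookup (insertAt c b _))
        (sym (trans (punchIn-punchOut (b≢redirect a≢b x)) (redirect-≢ a≢b x≢b))))
      (insertAt-punchIn c b _ (merge a≢b x))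

  ∑-merge : ∀ {v} k {a b : Fin v} (a≢b : a ≢ b) (f : Vec (Fin k) v → ℕ) (g : Vec (Fin k) (pred v) → ℕ) →
            (∀ c → lookup c a ≢ lookup c b → f c ≡ 0) →
            (∀ c c′ → (∀ x → lookup c x ≡ lookup c′ (merge a≢b x)) → f c ≡ g c′) →
            ∑ (colourings k v) f ≡ ∑ (colourings k (pred v)) g
  ∑-merge {suc v} k {a} {b} a≢b f g f≡0 f≡g = trans (∑-insertAt k b f)
    (∑-cong (colourings k v) λ c → trans
      (∑-single (lookup c (merge a≢b a)) (λ x → f (insertAt c b x)) (λ x x≢ → f≡0 _ λ eq → x≢
        (trans (sym (insertAt-lookup c b x)) (trans (sym eq) (at-a c x)))))
      (f≡g _ c (lookup-merge a≢b c)))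
    where
    at-a : ∀ c x → lookup (insertAt c b x) a ≡ lookup c (merge a≢b a)
    at-a c x = trans
      (cong (lookup (insertAt c b x))
        (sym (trans (punchIn-punchOut (b≢redirect a≢b a)) (redirect-≢ a≢b a≢b))))
      (insertAt-punchIn c b x (merge a≢b a))

  #ᵍ-deletion-contraction : ∀ {n v} (q : Fin n → Fin v) x y es (qx≢qy : q x ≢ q y) k →
    #ᵍ q es k ≡ #ᵍ q ((x , y) ∷ es) k + #ᵍ (merge qx≢qy ∘ q) es k
  #ᵍ-deletion-contraction {v = v} q x y es qx≢qy k = trans
    (∑-cong (colourings k v) split)
    (trans (∑-+ (ind ∘ properᵍ? q ((x , y) ∷ es)) mono (colourings k v))
      (cong (λ t → #ᵍ q ((x , y) ∷ es) k + t)
        (∑-merge k qx≢qy mono (ind ∘ properᵍ? (merge qx≢qy ∘ q) es) mono≡0 mono≡)))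
    where
    mono : Vec (Fin k) v → ℕ
    mono c with lookup c (q x) ≟ lookup c (q y)
    ... | yes _ = ind (properᵍ? q es c)
    ... | no  _ = 0
    mono≡0 : ∀ c → lookup c (q x) ≢ lookup c (q y) → mono c ≡ 0
    mono≡0 c ≠ with lookup c (q x) ≟ lookup c (q y)
    ... | yes eq = contradiction eq ≠
    ... | no  _ = refl
    split : ∀ c → ind (properᵍ? q es c) ≡ ind (properᵍ? q ((x , y) ∷ es) c) + mono c
    split c with lookup c (q x) ≟ lookup c (q y)
    ... | yes _ = refl
    ... | no  ≠ = sym (trans (ℕₚ.+-identityʳ _) (ind-cong _ (properᵍ? q es c) (λ { (_ ∷ p) → p }) (λ p → ≠ ∷ p)))
    mono≡ : ∀ c c′ → (∀ z → lookup c z ≡ lookup c′ (merge qx≢qy z)) →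
            mono c ≡ ind (properᵍ? (merge qx≢qy ∘ q) es c′)
    mono≡ c c′ eq with lookup c (q x) ≟ lookup c (q y)
    ... | yes _ = ind-cong (properᵍ? q es c) (properᵍ? (merge qx≢qy ∘ q) es c′)
      (All.map (λ ≠ p → ≠ (trans (eq _) (trans p (sym (eq _))))))
      (All.map (λ ≠ p → ≠ (trans (sym (eq _)) (trans p (eq _)))))
    ... | no ≠ = contradiction
      (trans (eq (q x)) (trans (cong (lookup c′) (merge-≡ qx≢qy)) (sym (eq (q y))))) ≠

  eval-chromatic : ∀ {n v} (q : Fin n → Fin v) es k → eval (chromatic q es) (+ k) ≡ + #ᵍ q es k
  eval-chromatic {v = v} q [] k = trans (eval-X^ v k) (cong +_ (sym (∑-colourings-1 k v)))
  eval-chromatic {v = v} q ((x , y) ∷ es) k with q x ≟ q y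
  ... | yes qx≡qy = cong +_ (sym (trans (∑-cong (colourings k v) none) (∑-0 (colourings k v))))
    where
    none : ∀ c → ind (properᵍ? q ((x , y) ∷ es) c) ≡ 0
    none c with properᵍ? q ((x , y) ∷ es) c
    ... | yes (≠ ∷ _) = contradiction (cong (lookup c) qx≡qy) ≠
    ... | no _        = refl
  ... | no qx≢qy = begin
    eval (chromatic q es -ₚ chromatic q/ es) (+ k)
      ≡⟨ eval-- (chromatic q es) (chromatic q/ es) (+ k) ⟩
    eval (chromatic q es) (+ k) ℤ.- eval (chromatic q/ es) (+ k)
      ≡⟨ cong₂ ℤ._-_ (eval-chromatic q es k) (eval-chromatic q/ es k) ⟩
    + #ᵍ q es k ℤ.- + #ᵍ q/ es k
      ≡⟨ cong (λ m → + m ℤ.- + #ᵍ q/ es k) (#ᵍ-deletion-contraction q x y es qx≢qy k) ⟩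
    + (#ᵍ q ((x , y) ∷ es) k + #ᵍ q/ es k) ℤ.- + #ᵍ q/ es k
      ≡⟨ cong (λ t → t ℤ.- + #ᵍ q/ es k) (ℤₚ.pos-+ (#ᵍ q ((x , y) ∷ es) k) (#ᵍ q/ es k)) ⟩
    + #ᵍ q ((x , y) ∷ es) k ℤ.+ + #ᵍ q/ es k ℤ.- + #ᵍ q/ es k
      ≡⟨ lem (+ #ᵍ q ((x , y) ∷ es) k) (+ #ᵍ q/ es k) ⟩
    + #ᵍ q ((x , y) ∷ es) k ∎
    where
    open ≡-Reasoning
    q/ = merge qx≢qy ∘ q
    lem : ∀ a b → a ℤ.+ b ℤ.- b ≡ a
    lem = solve-∀

χ-isChromaticPolynomial : ∀ H → IsChromaticPolynomial H (χ H)
χ-isChromaticPolynomial H k = trans (eval-chromatic id (Graph.edges H) k)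
  (cong +_ (sym (length-filter (proper? H) (colourings k (Graph.#vertices H)))))
  where open ChromaticCount

------------------------------------------------------------------------
-- Ribbon graphs

-- An edge disc is a rectangle: two opposite sides of it are the arcs where
-- it meets the vertex discs, the other two are free.  Its four corners lie
-- on vertex boundaries.  The involutions on the set of all corners send a
-- corner to the other endpoint of
--   attach : the arc joining the edge disc to a vertex disc,
--   side   : the free side of the edge disc,
--   rim    : the arc of a vertex boundary running to the next edge disc.
-- Vertex discs that meet no edge have no corners and are counted separately.
record RibbonGraph : Set where
  field
    #edges          : ℕ
    #corners        : ℕ
    isolated        : ℕ
    edge            : Fin #corners → Fin #edges
    corner          : Fin #edges → Fin #corners
    edge-corner     : ∀ e → edge (corner e) ≡ e

    attach side rim : Fin #corners → Fin #corners
    attach-inv      : Involutive _≡_ attach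
    side-inv        : Involutive _≡_ side
    rim-inv         : Involutive _≡_ rim
    attach-free     : ∀ x → attach x ≢ x
    side-free       : ∀ x → side x ≢ x
    rim-free        : ∀ x → rim x ≢ x

    side-attach     : ∀ x → side (attach x) ≡ attach (side x)
    side≢attach     : ∀ x → side x ≢ attach x
    edge-attach     : ∀ x → edge (attach x) ≡ edge x
    edge-side       : ∀ x → edge (side x) ≡ edge x
    same-edge       : ∀ x y → edge x ≡ edge y →
                      y ≡ x ⊎ y ≡ attach x ⊎ y ≡ side x ⊎ y ≡ side (attach x)

  vertexQuotient : Quotient (λ x y → y ≡ attach x ⊎ y ≡ rim x)
  vertexQuotient = ⟨ attach , rim ⟩-quotient

  boundaryQuotient : Quotient (λ x y → y ≡ side x ⊎ y ≡ rim x)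
  boundaryQuotient = ⟨ side , rim ⟩-quotient

#boundary : RibbonGraph → ℕ
#boundary G = Quotient.classes boundaryQuotient + isolated
  where open RibbonGraph G

underlying : RibbonGraph → Graph
underlying G = record
  { #vertices = classes + isolated
  ; edges     = map (λ e → vertexOf (corner e) , vertexOf (side (corner e))) (allFin _)
  }
  where
  open RibbonGraph G
  open Quotient vertexQuotient
  vertexOf : Fin #corners → Fin (classes + isolated)
  vertexOf x = class x ↑ˡ isolated

-- Half-twisting an edge disc reconnects its two free sides crosswise.
petrial : (G : RibbonGraph) → Subset (RibbonGraph.#edges G) → RibbonGraph
petrial G A = record
  { #edges      = G.#edges
  ; #corners    = G.#corners
  ; isolated    = G.isolated
  ; edge        = G.edge
  ; corner      = G.corner
  ; edge-corner = G.edge-corner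
  ; attach      = G.attach
  ; side        = side′
  ; rim         = G.rim
  ; attach-inv  = G.attach-inv
  ; side-inv    = side′-inv
  ; rim-inv     = G.rim-inv
  ; attach-free = G.attach-free
  ; side-free   = λ x → twist-free (lookup A (G.edge x)) x
  ; rim-free    = G.rim-free
  ; side-attach = side′-attach
  ; side≢attach = λ x → twist≢attach (lookup A (G.edge x)) x
  ; edge-attach = G.edge-attach
  ; edge-side   = λ x → edge-twist (lookup A (G.edge x)) x
  ; same-edge   = same-edge′
  }
  where
  module G = RibbonGraph G
  Corner = Fin G.#corners

  twist : Bool → Corner → Corner
  twist t x = if t then G.side (G.attach x) else G.side x

  side′ : Corner → Corner
  side′ x = twist (lookup A (G.edge x)) x

  edge-twist : ∀ t x → G.edge (twist t x) ≡ G.edge x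
  edge-twist true  x = trans (G.edge-side _) (G.edge-attach x)
  edge-twist false x = G.edge-side x

  twist-inv : ∀ t → Involutive _≡_ (twist t)
  twist-inv true  x = trans (cong G.side (sym (G.side-attach (G.attach x))))
    (trans (G.side-inv _) (G.attach-inv x))
  twist-inv false x = G.side-inv x

  side′-inv : Involutive _≡_ side′
  side′-inv x = trans
    (cong (λ e → twist (lookup A e) (side′ x)) (edge-twist (lookup A (G.edge x)) x))
    (twist-inv (lookup A (G.edge x)) x)

  twist-free : ∀ t x → twist t x ≢ x
  twist-free true  x eq = G.side≢attach x (trans (cong G.side (sym eq)) (G.side-inv _))
  twist-free false x = G.side-free x

  twist≢attach : ∀ t x → twist t x ≢ G.attach x
  twist≢attach true  x = G.side-free (G.attach x)
  twist≢attach false x = G.side≢attach x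

  twist-attach : ∀ t x → twist t (G.attach x) ≡ G.attach (twist t x)
  twist-attach true  x = G.side-attach (G.attach x)
  twist-attach false x = G.side-attach x

  side′-attach : ∀ x → side′ (G.attach x) ≡ G.attach (side′ x)
  side′-attach x = trans
    (cong (λ e → twist (lookup A e) (G.attach x)) (G.edge-attach x))
    (twist-attach (lookup A (G.edge x)) x)

  same-twist : ∀ t x y → y ≡ x ⊎ y ≡ G.attach x ⊎ y ≡ G.side x ⊎ y ≡ G.side (G.attach x) →
               y ≡ x ⊎ y ≡ G.attach x ⊎ y ≡ twist t x ⊎ y ≡ twist t (G.attach x)
  same-twist t     x y (inj₁ p)               = inj₁ p
  same-twist t     x y (inj₂ (inj₁ p))        = inj₂ (inj₁ p)
  same-twist false x y (inj₂ (inj₂ p))        = inj₂ (inj₂ p)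
  same-twist true  x y (inj₂ (inj₂ (inj₂ p))) = inj₂ (inj₂ (inj₁ p))
  same-twist true  x y (inj₂ (inj₂ (inj₁ p))) =
    inj₂ (inj₂ (inj₂ (trans p (cong G.side (sym (G.attach-inv x))))))

  same-edge′ : ∀ x y → G.edge x ≡ G.edge y →
               y ≡ x ⊎ y ≡ G.attach x ⊎ y ≡ side′ x ⊎ y ≡ side′ (G.attach x)
  same-edge′ x y eq =
    subst (λ e → y ≡ x ⊎ y ≡ G.attach x ⊎ y ≡ side′ x ⊎ y ≡ twist (lookup A e) (G.attach x))
      (sym (G.edge-attach x))
      (same-twist (lookup A (G.edge x)) x y (G.same-edge x y eq))

-- Discs glued along the boundary components are the new vertex discs, and
-- the old vertex discs are removed.  An edge disc meets the new vertex discs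
-- in its formerly free sides; the vertex arcs between edge discs stay.
dual : RibbonGraph → RibbonGraph
dual G = record
  { #edges      = #edges
  ; #corners    = #corners
  ; isolated    = isolated
  ; edge        = edge
  ; corner      = corner
  ; edge-corner = edge-corner
  ; attach      = side
  ; side        = attach
  ; rim         = rim
  ; attach-inv  = side-inv
  ; side-inv    = attach-inv
  ; rim-inv     = rim-inv
  ; attach-free = side-free
  ; side-free   = attach-free
  ; rim-free    = rim-free
  ; side-attach = λ x → sym (side-attach x)
  ; side≢attach = λ x eq → side≢attach x (sym eq)
  ; edge-attach = edge-side
  ; edge-side   = edge-attach
  ; same-edge   = λ x y eq → reorder x (same-edge x y eq)
  }
  where
  open RibbonGraph G
  reorder : ∀ x {y} → y ≡ x ⊎ y ≡ attach x ⊎ y ≡ side x ⊎ y ≡ side (attach x) →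
            y ≡ x ⊎ y ≡ side x ⊎ y ≡ attach x ⊎ y ≡ attach (side x)
  reorder x (inj₁ p)               = inj₁ p
  reorder x (inj₂ (inj₁ p))        = inj₂ (inj₂ (inj₁ p))
  reorder x (inj₂ (inj₂ (inj₁ p))) = inj₂ (inj₁ p)
  reorder x (inj₂ (inj₂ (inj₂ p))) = inj₂ (inj₂ (inj₂ (trans p (side-attach x))))

penrose : RibbonGraph → Poly
penrose G = ∑⊆ {RibbonGraph.#edges G} λ A → [-1]^ ∣ A ∣ ·ₚ X^ (#boundary (petrial G A))

-- Expanding χ by deletion–contraction over the edges of the dual leaves one
-- term, X^f, in which no edge is contracted, for each A.  Every other term
-- contracts some edge e of the dual, that is, identifies the two faces along
-- e.  The four corners of the edge disc e are then identified whether or not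
-- e is twisted, so the terms of A and of A △ {e} are equal and occur with
-- opposite signs.
module Submission where

open import Defs
open import Data.Bool using (Bool; if_then_else_)
open import Data.Fin using (Fin; zero; suc; join; splitAt; _≟_)
open import Data.Fin.Properties using (cantor-schröder-bernstein; join-splitAt; splitAt-join)
open import Data.Fin.Subset using (Subset; inside; outside; ∣_∣)
open import Data.Integer using (ℤ; _+_; _-_; _*_; 0ℤ; 1ℤ; -1ℤ)
import Data.Integer.Properties as ℤₚ
open import Data.Integer.Tactic.RingSolver using (solve-∀)
open import Data.List using (List; []; _∷_; _++_; map; foldr; allFin)
open import Data.List.Properties using (map-++; map-∘)
open import Data.Nat as ℕ using (ℕ; zero; suc)
open import Data.Product using (_×_; _,_; proj₁; proj₂; ∃)
open import Data.Sum as Sum using (_⊎_; inj₁; inj₂)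
open import Data.Sum.Properties using (inj₁-injective)
open import Data.Vec using ([]; _∷_; lookup)
open import Function using (_∘_; id)
open import Function.Definitions using (StrictlySurjective)
import Relation.Binary.Construct.Closure.Equivalence as EqC
open import Relation.Binary.PropositionalEquality
open import Relation.Nullary using (yes; no; contradiction)

-- Coefficients of polynomial sums and of sums over subsets.

coeff-+ : ∀ p q i → coeff (p +ₚ q) i ≡ coeff p i + coeff q i
coeff-+ []      q       i       = sym (ℤₚ.+-identityˡ _)
coeff-+ (a ∷ p) []      i       = sym (ℤₚ.+-identityʳ _)
coeff-+ (a ∷ p) (b ∷ q) zero    = refl
coeff-+ (a ∷ p) (b ∷ q) (suc i) = coeff-+ p q i

coeff-· : ∀ a p i → coeff (a ·ₚ p) i ≡ a * coeff p i
coeff-· a []      i       = sym (ℤₚ.*-zeroʳ a)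
coeff-· a (b ∷ p) zero    = refl
coeff-· a (b ∷ p) (suc i) = coeff-· a p i

coeff-- : ∀ p q i → coeff (p -ₚ q) i ≡ coeff p i - coeff q i
coeff-- p q i = trans (coeff-+ p (-1ℤ ·ₚ q) i)
  (cong (coeff p i +_) (trans (coeff-· -1ℤ q i) (ℤₚ.-1*i≡-i (coeff q i))))

coeff-foldr-++ : ∀ ps qs i → coeff (foldr _+ₚ_ [] (ps ++ qs)) i ≡
                 coeff (foldr _+ₚ_ [] ps) i + coeff (foldr _+ₚ_ [] qs) i
coeff-foldr-++ []       qs i = sym (ℤₚ.+-identityˡ _)
coeff-foldr-++ (p ∷ ps) qs i = begin
  coeff (p +ₚ foldr _+ₚ_ [] (ps ++ qs)) i       ≡⟨ coeff-+ p _ i ⟩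
  coeff p i + coeff (foldr _+ₚ_ [] (ps ++ qs)) i ≡⟨ cong (coeff p i +_) (coeff-foldr-++ ps qs i) ⟩
  coeff p i + (P + Q)                            ≡⟨ ℤₚ.+-assoc (coeff p i) P Q ⟨
  coeff p i + P + Q                              ≡⟨ cong (_+ Q) (coeff-+ p _ i) ⟨
  coeff (p +ₚ foldr _+ₚ_ [] ps) i + Q            ∎
  where
  open ≡-Reasoning
  P = coeff (foldr _+ₚ_ [] ps) i
  Q = coeff (foldr _+ₚ_ [] qs) i

coeff-∑⊆-suc : ∀ {n} (F : Subset (suc n) → Poly) i →
               coeff (∑⊆ F) i ≡ coeff (∑⊆ (F ∘ (outside ∷_))) i + coeff (∑⊆ (F ∘ (inside ∷_))) i
coeff-∑⊆-suc {n} F i = begin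
  coeff (sum (map F (map (outside ∷_) Ss ++ map (inside ∷_) Ss))) i
    ≡⟨ cong (λ ps → coeff (sum ps) i) (map-++ F (map (outside ∷_) Ss) _) ⟩
  coeff (sum (map F (map (outside ∷_) Ss) ++ map F (map (inside ∷_) Ss))) i
    ≡⟨ coeff-foldr-++ (map F (map (outside ∷_) Ss)) _ i ⟩
  coeff (sum (map F (map (outside ∷_) Ss))) i + coeff (sum (map F (map (inside ∷_) Ss))) i
    ≡⟨ cong₂ (λ ps qs → coeff (sum ps) i + coeff (sum qs) i) (map-∘ Ss) (map-∘ Ss) ⟨
  coeff (∑⊆ (F ∘ (outside ∷_))) i + coeff (∑⊆ (F ∘ (inside ∷_))) i ∎
  where
  open ≡-Reasoning
  Ss  = subsets n
  sum = foldr _+ₚ_ []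

-- Alternating sums over subsets, and their cancellation in pairs.

∑± : ∀ {n} → (Subset n → ℤ) → ℤ
∑± {zero}  g = g []
-- The sign of the term of `A` is built up by these subtractions, one for each element of `A`.
∑± {suc n} g = ∑± (g ∘ (outside ∷_)) - ∑± (g ∘ (inside ∷_))

∑±-cong : ∀ {n} {g h : Subset n → ℤ} → (∀ A → g A ≡ h A) → ∑± g ≡ ∑± h
∑±-cong {zero}  eq = eq []
∑±-cong {suc n} eq = cong₂ _-_ (∑±-cong (eq ∘ (outside ∷_))) (∑±-cong (eq ∘ (inside ∷_)))

∑±-- : ∀ {n} (g h : Subset n → ℤ) → ∑± (λ A → g A - h A) ≡ ∑± g - ∑± h
∑±-- {zero}  g h = refl
∑±-- {suc n} g h = trans
  (cong₂ _-_ (∑±-- (g ∘ (outside ∷_)) (h ∘ (outside ∷_))) (∑±-- (g ∘ (inside ∷_)) (h ∘ (inside ∷_))))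
  (interchange (∑± (g ∘ (outside ∷_))) (∑± (h ∘ (outside ∷_)))
               (∑± (g ∘ (inside ∷_))) (∑± (h ∘ (inside ∷_))))
  where
  interchange : ∀ a b c d → (a - b) - (c - d) ≡ (a - c) - (b - d)
  interchange = solve-∀

infix 4 _≡_off_
_≡_off_ : ∀ {n} → Subset n → Subset n → Fin n → Set
A ≡ B off e = ∀ e′ → e′ ≢ e → lookup A e′ ≡ lookup B e′

off-sym : ∀ {n} (A B : Subset n) {e} → A ≡ B off e → B ≡ A off e
off-sym A B A≡B e′ ≢e = sym (A≡B e′ ≢e)

-- The terms of `A` and `A` △ e are equal and have opposite signs. At `zero` the outermost
-- subtraction separates the two; at `suc e` each half vanishes by induction.
∑±-cancel : ∀ {n} (e : Fin n) (g : Subset n → ℤ) →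
            (∀ A B → A ≡ B off e → g A ≡ g B) → ∑± g ≡ 0ℤ
∑±-cancel zero g g-off = trans
  (cong (_- ∑± (g ∘ (inside ∷_)))
    (∑±-cong (λ A → g-off (outside ∷ A) (inside ∷ A)
      λ { zero ≢zero → contradiction refl ≢zero ; (suc _) _ → refl })))
  (ℤₚ.+-inverseʳ (∑± (g ∘ (inside ∷_))))
∑±-cancel (suc e) g g-off = cong₂ _-_ (half outside) (half inside)
  where
  half : ∀ (s : Bool) → ∑± (g ∘ (s ∷_)) ≡ 0ℤ
  half s = ∑±-cancel e (g ∘ (s ∷_)) λ A B A≡B → g-off (s ∷ A) (s ∷ B)
    λ { zero _ → refl ; (suc e′) ≢e → A≡B e′ (≢e ∘ cong suc) }

-- The scalar s absorbs the sign produced by an inside head.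
coeff-∑⊆-scaled : ∀ {n} (F : Subset n → Poly) (g : Subset n → ℤ) s i →
                  (∀ A → coeff (F A) i ≡ s * ([-1]^ ∣ A ∣ * g A)) → coeff (∑⊆ F) i ≡ s * ∑± g
coeff-∑⊆-scaled {zero} F g s i eq = begin
  coeff (F [] +ₚ []) i ≡⟨ coeff-+ (F []) [] i ⟩
  coeff (F []) i + 0ℤ  ≡⟨ ℤₚ.+-identityʳ _ ⟩
  coeff (F []) i       ≡⟨ eq [] ⟩
  s * (1ℤ * g [])      ≡⟨ cong (s *_) (ℤₚ.*-identityˡ (g [])) ⟩
  s * g []             ∎
  where open ≡-Reasoning
coeff-∑⊆-scaled {suc n} F g s i eq = begin
  coeff (∑⊆ F) i
    ≡⟨ coeff-∑⊆-suc F i ⟩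
  coeff (∑⊆ (F ∘ (outside ∷_))) i + coeff (∑⊆ (F ∘ (inside ∷_))) i
    ≡⟨ cong₂ _+_
         (coeff-∑⊆-scaled (F ∘ (outside ∷_)) (g ∘ (outside ∷_)) s i (eq ∘ (outside ∷_)))
         (coeff-∑⊆-scaled (F ∘ (inside ∷_)) (g ∘ (inside ∷_)) (s * -1ℤ) i
           (λ A → trans (eq (inside ∷ A)) (regroup s ([-1]^ ∣ A ∣) (g (inside ∷ A))))) ⟩
  s * ∑± (g ∘ (outside ∷_)) + (s * -1ℤ) * ∑± (g ∘ (inside ∷_))
    ≡⟨ factor s (∑± (g ∘ (outside ∷_))) (∑± (g ∘ (inside ∷_))) ⟩
  s * ∑± g ∎
  where
  open ≡-Reasoning
  regroup : ∀ s m x → s * ((-1ℤ * m) * x) ≡ (s * -1ℤ) * (m * x)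
  regroup = solve-∀
  factor : ∀ s x y → s * x + (s * -1ℤ) * y ≡ s * (x - y)
  factor = solve-∀

coeff-∑⊆ : ∀ {n} (f : Subset n → Poly) i →
           coeff (∑⊆ (λ A → [-1]^ ∣ A ∣ ·ₚ f A)) i ≡ ∑± (λ A → coeff (f A) i)
coeff-∑⊆ f i = trans
  (coeff-∑⊆-scaled _ (λ A → coeff (f A) i) 1ℤ i
    (λ A → trans (coeff-· ([-1]^ ∣ A ∣) (f A) i) (sym (ℤₚ.*-identityˡ _))))
  (ℤₚ.*-identityˡ _)

-- Partitions given by maps, and the chromatic polynomial.

infix 4 _⊑_
-- Inclusion of kernels: the partition defined by `q` refines the one defined by `r`.
_⊑_ : {X B C : Set} → (X → B) → (X → C) → Set
q ⊑ r = ∀ {z w} → q z ≡ q w → r z ≡ r w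

-- `redirect` moves only the class of `y`, into that of `x`, and `r` agrees on these two points.
merge-least : ∀ {X B : Set} {v} {q : X → Fin v} {x y} (qx≢qy : q x ≢ q y) {r : X → B} →
              q ⊑ r → r x ≡ r y → merge qx≢qy ∘ q ⊑ r
merge-least {q = q} {x} {y} qx≢qy {r} q⊑r rx≡ry {z} {w} = glue z w ∘ merge-injective qx≢qy
  where
  glue : ∀ z w → redirect qx≢qy (q z) ≡ redirect qx≢qy (q w) → r z ≡ r w
  glue z w eq with q z ≟ q y | q w ≟ q y
  ... | yes p | yes p′ = q⊑r (trans p (sym p′))
  ... | yes p | no  _  = trans (q⊑r p) (trans (sym rx≡ry) (q⊑r eq))
  ... | no  _ | yes p′ = trans (q⊑r eq) (trans rx≡ry (sym (q⊑r p′)))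
  ... | no  _ | no  _  = q⊑r eq

-- Deletion-contraction only tests which points share a class and, at the end, counts the vertices
-- left. Merging the same pair on both sides keeps the kernels equal and lowers both counts by one.
-- The kernel alone does not fix the count, as `q` and `r` may miss vertices.
chromatic-kernel : ∀ {n v v′} {q : Fin n → Fin v} {r : Fin n → Fin v′} → v ≡ v′ → q ⊑ r → r ⊑ q →
                   ∀ es → chromatic q es ≡ chromatic r es
chromatic-kernel refl q⊑r r⊑q [] = refl
chromatic-kernel {q = q} {r} refl q⊑r r⊑q ((x , y) ∷ es) with q x ≟ q y | r x ≟ r y
... | yes _ | yes _ = refl
... | yes p | no ¬p = contradiction (q⊑r p) ¬p
... | no ¬p | yes p = contradiction (r⊑q p) ¬p
... | no q≢ | no r≢ = cong₂ _-ₚ_ (chromatic-kernel refl q⊑r r⊑q es)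
  (chromatic-kernel refl
    (merge-least q≢ {r = merge r≢ ∘ r} (λ eq → cong (merge r≢) (q⊑r eq)) (merge-≡ r≢))
    (merge-least r≢ {r = merge q≢ ∘ q} (λ eq → cong (merge q≢) (r⊑q eq)) (merge-≡ q≢)) es)

-- A partition of `X` with numbered classes; surjectivity makes their number depend on the kernel
-- alone.
record Surjection (X : Set) : Set where
  field
    size       : ℕ
    to         : X → Fin size
    surjective : StrictlySurjective _≡_ to

open Surjection

-- Sending a class of one partition to the class of a representative in the other gives injections
-- both ways.
size-≡ : ∀ {X} (q r : Surjection X) → to q ⊑ to r → to r ⊑ to q → size q ≡ size r
size-≡ q r q⊑r r⊑q = cantor-schröder-bernstein (injective q r r⊑q) (injective r q q⊑r)
  where
  injective : ∀ q r → to r ⊑ to q → ∀ {i j} →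
              to r (proj₁ (surjective q i)) ≡ to r (proj₁ (surjective q j)) → i ≡ j
  injective q r r⊑q {i} {j} eq =
    trans (sym (proj₂ (surjective q i))) (trans (r⊑q eq) (proj₂ (surjective q j)))

chromatic-≡ : ∀ {X n} (ι : Fin n → X) (q r : Surjection X) → to q ⊑ to r → to r ⊑ to q →
              ∀ es → chromatic (to q ∘ ι) es ≡ chromatic (to r ∘ ι) es
chromatic-≡ ι q r q⊑r r⊑q = chromatic-kernel (size-≡ q r q⊑r r⊑q) q⊑r r⊑q

chromatic-map : ∀ {E : Set} {m n v} (q : Fin n → Fin v) (f : Fin m → Fin n) (a b : E → Fin m) es →
                chromatic q (map (λ e → f (a e) , f (b e)) es) ≡
                chromatic (q ∘ f) (map (λ e → a e , b e) es)
chromatic-map q f a b []       = refl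
chromatic-map q f a b (e ∷ es) with q (f (a e)) ≟ q (f (b e))
... | yes _ = refl
... | no  ≢ = cong₂ _-ₚ_ (chromatic-map q f a b es) (chromatic-map (merge ≢ ∘ q) f a b es)

-- The universal property of identifying `x` with `y`. It also covers points already in one class,
-- so contractions can be compared without a case distinction on loops.
record Contraction {X : Set} (q : Surjection X) (x y : X) : Set₁ where
  field
    contracted : Surjection X
    coarser    : to q ⊑ to contracted
    glued      : to contracted x ≡ to contracted y
    least      : ∀ {B : Set} {r : X → B} → to q ⊑ r → r x ≡ r y → to contracted ⊑ r

open Contraction

contract : ∀ {X} (q : Surjection X) x y → Contraction q x y
contract q x y with to q x ≟ to q y
... | yes qx≡qy = record
  { contracted = q
  ; coarser    = id
  ; glued      = qx≡qy
  ; least      = λ q⊑r _ → q⊑r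
  }
... | no qx≢qy = record
  { contracted = record
    { to         = merge qx≢qy ∘ to q
    ; surjective = λ j →
        let (i , i↦j) = merge-surjective qx≢qy j
            (z , z↦i) = surjective q i
        in z , trans (cong (merge qx≢qy) z↦i) i↦j
    }
  ; coarser    = cong (merge qx≢qy)
  ; glued      = merge-≡ qx≢qy
  ; least      = merge-least qx≢qy
  }

-- Loops obey the same formula: contracting a loop changes nothing, so the difference is zero.
coeff-chromatic-∷ : ∀ {X n} (ι : Fin n → X) (q : Surjection X) x y es i →
  coeff (chromatic (to q ∘ ι) ((x , y) ∷ es)) i ≡
  coeff (chromatic (to q ∘ ι) es) i -
  coeff (chromatic (to (contracted (contract q (ι x) (ι y))) ∘ ι) es) i
coeff-chromatic-∷ ι q x y es i with to q (ι x) ≟ to q (ι y)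
... | yes _ = sym (ℤₚ.+-inverseʳ (coeff (chromatic (to q ∘ ι) es) i))
... | no  _ = coeff-- (chromatic (to q ∘ ι) es) _ i

-- Faces of partial Petrials and their identification along an edge.

module _ (G : RibbonGraph) where

  open RibbonGraph G using (#edges; #corners; isolated; edge; corner; edge-corner; attach; side)

  module P (A : Subset #edges) = RibbonGraph (petrial G A)
  module F (A : Subset #edges) = Quotient (P.boundaryQuotient A)

  -- Each vertex disc without corners carries one boundary component, which
  -- the second summand accounts for.
  Point : Set
  Point = Fin #corners ⊎ Fin isolated

  faces : Subset #edges → Surjection Point
  faces A = record
    { size       = F.classes A ℕ.+ isolated
    ; to         = face
    ; surjective = λ j → let (x , x↦) = surj (splitAt (F.classes A) j) in
        x , trans (cong (join (F.classes A) isolated) x↦) (join-splitAt (F.classes A) isolated j)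
    }
    where
    face : Point → Fin (F.classes A ℕ.+ isolated)
    face = join (F.classes A) isolated ∘ Sum.map₁ (F.class A)
    surj : ∀ s → ∃ λ x → Sum.map₁ (F.class A) x ≡ s
    surj (inj₁ k) = let (x , x↦k) = F.surjective A k in inj₁ x , cong inj₁ x↦k
    surj (inj₂ k) = inj₂ k , refl

  face-complete : ∀ A {x y} → to (faces A) x ≡ to (faces A) y →
                  Sum.map₁ (F.class A) x ≡ Sum.map₁ (F.class A) y
  face-complete A {x} {y} eq = trans (sym (splitAt-join (F.classes A) isolated _))
    (trans (cong (splitAt (F.classes A)) eq) (splitAt-join (F.classes A) isolated _))

  face-sound : ∀ A {x y} → y ≡ P.side A x ⊎ y ≡ P.rim A x →
               to (faces A) (inj₁ x) ≡ to (faces A) (inj₁ y)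
  face-sound A step =
    cong (join (F.classes A) isolated ∘ inj₁) (F.sound A (EqC.return step))

  -- Corners share a face exactly when `side` and `rim` steps connect them, so single steps suffice;
  -- an isolated disc is alone in its class.
  faces-least : ∀ {B : Set} A {r : Point → B} →
                (∀ {x y} → y ≡ P.side A x ⊎ y ≡ P.rim A x → r (inj₁ x) ≡ r (inj₁ y)) →
                to (faces A) ⊑ r
  faces-least A {r} r-step {z} {w} eq = factor z w (face-complete A {z} {w} eq)
    where
    factor : ∀ z w → Sum.map₁ (F.class A) z ≡ Sum.map₁ (F.class A) w → r z ≡ r w
    factor (inj₁ x) (inj₁ y) p = EqC.fold
      (record { refl = refl ; sym = sym ; trans = trans }) r-step (F.complete A (inj₁-injective p))
    factor (inj₂ _) (inj₂ _) refl = refl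

  -- Duality exchanges `attach` and `side`, so these corners lie on the two faces joined by the dual
  -- edge `e`. Twisting leaves `attach` unchanged, so the same two points serve for every `A`.
  glue : ∀ A e → Contraction (faces A) (inj₁ (corner e)) (inj₁ (attach (corner e)))
  glue A e = contract (faces A) _ _

  glued-faces : Subset #edges → Fin #edges → Surjection Point
  glued-faces A e = contracted (glue A e)

  -- A `side` step, twisted or not, stays in one face, and the gluing links a corner to its `attach`
  -- partner; this reaches all four corners of `e`.
  glued-edge : ∀ A e {x} → edge x ≡ e → to (glued-faces A e) (inj₁ (corner e)) ≡ to (glued-faces A e) (inj₁ x)
  glued-edge A e {x} x∈e with P.same-edge A (corner e) x (trans (edge-corner e) (sym x∈e))
  ... | inj₁ refl                  = refl
  ... | inj₂ (inj₁ refl)           = glued (glue A e)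
  ... | inj₂ (inj₂ (inj₁ refl))    = coarser (glue A e) (face-sound A (inj₁ refl))
  ... | inj₂ (inj₂ (inj₂ refl))    =
    trans (glued (glue A e)) (coarser (glue A e) (face-sound A (inj₁ refl)))

  glued-faces-⊑ : ∀ A B e → A ≡ B off e → to (glued-faces A e) ⊑ to (glued-faces B e)
  glued-faces-⊑ A B e A≡B = least (glue A e) (faces-least A {to (glued-faces B e)} step) (glued (glue B e))
    where
    step : ∀ {x y} → y ≡ P.side A x ⊎ y ≡ P.rim A x →
           to (glued-faces B e) (inj₁ x) ≡ to (glued-faces B e) (inj₁ y)
    step (inj₂ p) = coarser (glue B e) (face-sound B (inj₂ p))
    step {x} (inj₁ refl) with edge x ≟ e
    -- `A` and `B` may twist `e` differently, but the step stays among the corners of `e`, all glued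
    -- in `B`.
    ... | yes x∈e = trans (sym (glued-edge B e x∈e))
                          (glued-edge B e (trans (P.edge-side A x) x∈e))
    -- Away from `e` both sets twist alike, so this is also a `side` step for `B`.
    ... | no  x∉e = coarser (glue B e) (face-sound B (inj₁
      (cong (λ t → if t then side (attach x) else side x)
        (A≡B (edge x) x∉e))))

  -- Deletion-contraction over the edges of the dual.

  ends : List (Fin #edges) → List (Fin #corners × Fin #corners)
  ends = map (λ e → corner e , attach (corner e))

  faceχ : Subset #edges → List (Fin #edges) → Poly
  faceχ A es = chromatic (to (faces A) ∘ inj₁) (ends es)

  -- The vertex classes of the dual are the boundary classes by computation, so only the labelling
  -- of edge ends has to move from the edge list into the map.
  χ-dual-petrial : ∀ A → χ (underlying (dual (petrial G A))) ≡ faceχ A (allFin #edges)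
  χ-dual-petrial A = chromatic-map id (to (faces A) ∘ inj₁) corner (attach ∘ corner) (allFin #edges)

  ∑±-faceχ : ∀ i es → ∑± (λ A → coeff (faceχ A es) i) ≡ ∑± (λ A → coeff (faceχ A []) i)
  ∑±-faceχ i []       = refl
  ∑±-faceχ i (e ∷ es) = begin
    ∑± (λ A → coeff (faceχ A (e ∷ es)) i)
      ≡⟨ ∑±-cong (λ A → coeff-chromatic-∷ inj₁ (faces A) (corner e) (attach (corner e)) (ends es) i) ⟩
    ∑± (λ A → coeff (faceχ A es) i - gluedχ A)
      ≡⟨ ∑±-- (λ A → coeff (faceχ A es) i) gluedχ ⟩
    ∑± (λ A → coeff (faceχ A es) i) - ∑± gluedχ
      -- The contracted term does not depend on whether `e` lies in `A`, so its alternating sum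
      -- vanishes.
      ≡⟨ cong₂ _-_ (∑±-faceχ i es) (∑±-cancel e gluedχ gluedχ-off) ⟩
    ∑± (λ A → coeff (faceχ A []) i) - 0ℤ
      ≡⟨ ℤₚ.+-identityʳ _ ⟩
    ∑± (λ A → coeff (faceχ A []) i) ∎
    where
    open ≡-Reasoning
    gluedχ : Subset #edges → ℤ
    gluedχ A = coeff (chromatic (to (glued-faces A e) ∘ inj₁) (ends es)) i
    gluedχ-off : ∀ A B → A ≡ B off e → gluedχ A ≡ gluedχ B
    gluedχ-off A B A≡B = cong (λ p → coeff p i)
      (chromatic-≡ inj₁ (glued-faces A e) (glued-faces B e)
        (glued-faces-⊑ A B e A≡B) (glued-faces-⊑ B A e (off-sym A B A≡B)) (ends es))

theorem5p3 : (G : RibbonGraph) →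
    penrose G ≈ₚ ∑⊆ {RibbonGraph.#edges G} (λ A → [-1]^ ∣ A ∣ ·ₚ χ (underlying (dual (petrial G A))))
theorem5p3 G i = begin
  coeff (penrose G) i
    ≡⟨ coeff-∑⊆ (λ A → X^ (#boundary (petrial G A))) i ⟩
  -- With no edge left, `faceχ G A []` computes to `X^ (#boundary (petrial G A))`.
  ∑± (λ A → coeff (faceχ G A []) i)
    ≡⟨ ∑±-faceχ G i (allFin _) ⟨
  ∑± (λ A → coeff (faceχ G A (allFin _)) i)
    ≡⟨ ∑±-cong (λ A → cong (λ p → coeff p i) (χ-dual-petrial G A)) ⟨
  ∑± (λ A → coeff (χ (underlying (dual (petrial G A)))) i)
    ≡⟨ coeff-∑⊆ (λ A → χ (underlying (dual (petrial G A)))) i ⟨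
  coeff (∑⊆ (λ A → [-1]^ ∣ A ∣ ·ₚ χ (underlying (dual (petrial G A))))) i ∎
  where open ≡-Reasoning
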